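{- Let $t\ge2$, $N=t+2$, and let $\lambda$ be a partition with at most $N$ parts, with $t$-quotient $(\lambda^{(0)},\dots,\lambda^{(t-1)})$. For a partition $\nu$ put $k(\nu)=\nu_1-\nu_2$. If exactly two residue classes $r_A<r_B$ modulo $t$ contain two elements of $\beta(\lambda)$ and all others contain one (two-class profile), then $$d_1=t\bigl(k(\lambda^{(r_A)})+1\bigr),\qquad d_2=t\bigl(k(\lambda^{(r_B)})+1\bigr),\qquad \tilde d_3=t\bigl(|\lambda^{(r_A)}|-|\lambda^{(r_B)}|\bigr)+2(r_A-r_B).$$ If exactly one residue class $r_A$ contains three elements of $\beta(\lambda)$ and all others contain one (size-three profile), then $\lambda^{(r_A)}$ has three parts (zeros allowed) and $$d_1=t\bigl(\lambda^{(r_A)}_1-\lambda^{(r_A)}_2+1\bigr),\qquad d_2=t\bigl(\lambda^{(r_A)}_2-\lambda^{(r_A)}_3+1\bigr),\qquad \tilde d_3=d_1+d_2.$$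
   Context: For $\lambda=(\lambda_1\ge\dots\ge\lambda_N\ge0)$ let $\beta_j=\lambda_j+N-j$ and $\beta(\lambda)=\{\beta_1>\dots>\beta_N\}$. The $t$-quotient is computed from this beta set with $N$ elements: if the elements of $\beta(\lambda)$ congruent to $i$ modulo $t$ are $t\tilde a_1+i>t\tilde a_2+i>\dots>t\tilde a_{n}+i$, then $\lambda^{(i)}=(\tilde a_1-n+1,\tilde a_2-n+2,\dots,\tilde a_n)$. In the two-class profile $A=\{a_1>a_2\}$ and $B=\{b_1>b_2\}$ are the elements of $\beta(\lambda)$ in classes $r_A$ and $r_B$; in the size-three profile, with class $\{p>q>r\}$, $A=\{a_1>a_2\}=\{p,q\}$ and $B=\{b_1>b_2\}=\{q,r\}$. In both cases $d_1=a_1-a_2$, $d_2=b_1-b_2$, $\tilde d_3=a_1+a_2-b_1-b_2$. -}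

module Defs where

open import Data.Fin using (Fin; toℕ)
open import Data.Integer using (ℤ; +_; _-_) renaming (_+_ to _+ℤ_)
open import Data.List using (List; []; _∷_; length; map; filter)
open import Data.List.Relation.Unary.All using (All; []; _∷_)
open import Data.List.Relation.Unary.All.Properties using (all-filter)
open import Data.List.Relation.Unary.Linked using (Linked; []; [-]; _∷_)
import Data.List.Relation.Unary.Linked.Properties as Linked
open import Data.Nat using (ℕ; suc; _+_; _*_; _∸_; _<_; _≥_; _>_; NonZero; _/_; _%_; s≤s)
open import Data.Nat.ListAction using (sum)
open import Data.Nat.DivMod using (m≡m%n+[m/n]*n)
open import Data.Nat.Properties
open import Data.Product using (_×_; _,_)
open import Relation.Binary.PropositionalEquality using (_≡_; _≢_; sym; trans; cong)

-- Trailing zeros are allowed, so a partition with at most N parts is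
-- represented by its sequence of exactly N weakly decreasing entries.  The
-- beta set depends on this length.
record Partition : Set where
  constructor partition
  field
    parts      : List ℕ
    decreasing : Linked _≥_ parts

open Partition public

size : Partition → ℕ
size ν = sum (parts ν)

-- ν₁ - ν₂, where missing parts are zero.
k : Partition → ℤ
k (partition []          _) = + 0
k (partition (x ∷ [])    _) = + x
k (partition (x ∷ y ∷ _) _) = + x - + y

-- The j-th of N entries becomes λⱼ + N - j, because N - j entries follow it.
-- Beta sets are kept as lists in strictly decreasing order (beta-decreasing).
beta : List ℕ → List ℕ
beta []       = []
beta (x ∷ xs) = x + length xs ∷ beta xs

-- (ã₁ > … > ãₙ) ↦ (ã₁ - n + 1, ã₂ - n + 2, …, ãₙ).  On strictly decreasing
-- lists ãⱼ ≥ n - j, so the subtraction is never truncated.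
unbeta : List ℕ → List ℕ
unbeta []       = []
unbeta (a ∷ as) = a ∸ length as ∷ unbeta as

beta-decreasing : ∀ {xs} → Linked _≥_ xs → Linked _>_ (beta xs)
beta-decreasing []  = []
beta-decreasing [-] = [-]
beta-decreasing {x ∷ y ∷ ys} (x≥y ∷ l) =
  ≤-trans (s≤s (+-monoˡ-≤ (length ys) x≥y)) (≤-reflexive (sym (+-suc x (length ys))))
  ∷ beta-decreasing l

unbeta-decreasing : ∀ {as} → Linked _>_ as → Linked _≥_ (unbeta as)
unbeta-decreasing []  = []
unbeta-decreasing [-] = [-]
unbeta-decreasing {a ∷ b ∷ cs} (a>b ∷ l) =
  ∸-monoˡ-≤ (suc (length cs)) a>b ∷ unbeta-decreasing l

module _ (t : ℕ) .{{_ : NonZero t}} where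

  residueClass : Partition → Fin t → List ℕ
  residueClass μ i = filter (λ x → x % t ≟ toℕ i) (beta (parts μ))

  residueClass-decreasing : ∀ μ i → Linked _>_ (residueClass μ i)
  residueClass-decreasing μ i =
    Linked.filter⁺ (λ x → x % t ≟ toℕ i) (λ p q → <-trans q p) (beta-decreasing (decreasing μ))

  /-strict : ∀ {x y r} → x % t ≡ r → y % t ≡ r → y < x → y / t < x / t
  /-strict {x} {y} px py y<x = ≰⇒> λ x/t≤y/t → <⇒≱ y<x (begin
    x                    ≡⟨ m≡m%n+[m/n]*n x t ⟩
    x % t + x / t * t    ≡⟨ cong (_+ x / t * t) (trans px (sym py)) ⟩
    y % t + x / t * t    ≤⟨ +-monoʳ-≤ (y % t) (*-monoˡ-≤ t x/t≤y/t) ⟩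
    y % t + y / t * t    ≡⟨ m≡m%n+[m/n]*n y t ⟨
    y                    ∎)
    where open ≤-Reasoning

  map-/-decreasing : ∀ {r xs} → All (λ x → x % t ≡ r) xs → Linked _>_ xs →
                     Linked _>_ (map (_/ t) xs)
  map-/-decreasing _              []        = []
  map-/-decreasing _              [-]       = [-]
  map-/-decreasing (p ∷ q ∷ rest) (x>y ∷ l) =
    /-strict p q x>y ∷ map-/-decreasing (q ∷ rest) l

  -- An element t ã + i of the i-th class has quotient ã.
  quotient : Partition → Fin t → Partition
  quotient μ i = partition
    (unbeta (map (_/ t) (residueClass μ i)))
    (unbeta-decreasing (map-/-decreasing
      (all-filter (λ x → x % t ≟ toℕ i) (beta (parts μ)))
      (residueClass-decreasing μ i)))

  record TwoClassProfile (μ : Partition) (rA rB : Fin t) : Set where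
    field
      ordered : toℕ rA < toℕ rB
      countA  : length (residueClass μ rA) ≡ 2
      countB  : length (residueClass μ rB) ≡ 2
      others  : ∀ r → r ≢ rA → r ≢ rB → length (residueClass μ r) ≡ 1

  record SizeThreeProfile (μ : Partition) (rA : Fin t) : Set where
    field
      countA : length (residueClass μ rA) ≡ 3
      others : ∀ r → r ≢ rA → length (residueClass μ r) ≡ 1

-- d₁ = d A and d₂ = d B for the pairs A = (a₁ , a₂) and B = (b₁ , b₂).
d : ℕ × ℕ → ℤ
d (x , y) = + x - + y

d̃₃ : ℕ × ℕ → ℕ × ℕ → ℤ
d̃₃ (a₁ , a₂) (b₁ , b₂) = + a₁ +ℤ + a₂ - + b₁ - + b₂

{-# OPTIONS --safe #-}
module Submission where

open import Defs
open import Data.Fin using (Fin; toℕ)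
open import Data.Integer using (ℤ; +_; _+_; _-_; _*_)
open import Data.Integer.Properties using (pos-*)
open import Data.Integer.Tactic.RingSolver using (solve-∀)
open import Data.List using (List; []; _∷_; length; map)
open import Data.List.Relation.Unary.All using (All; []; _∷_)
open import Data.List.Relation.Unary.All.Properties using (all-filter)
open import Data.List.Relation.Unary.Linked using (Linked; []; [-]; _∷_)
open import Data.Nat as ℕ using (ℕ; NonZero; _≤_; _>_; z≤n)
open import Data.Nat.DivMod using (m≡m%n+[m/n]*n)
import Data.Nat.Properties as ℕ
open import Data.Product using (_×_; _,_; ∃-syntax)
open import Relation.Binary.PropositionalEquality
  using (_≡_; refl; sym; trans; cong; cong₂; module ≡-Reasoning)

-- On strictly decreasing lists beta inverts unbeta, so the elements of class i
-- are recovered from the quotient as i + β t with β in beta (λ⁽ⁱ⁾).  All the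
-- formulas are then linear identities in the parts of λ⁽ⁱ⁾.

length-unbeta : ∀ as → length (unbeta as) ≡ length as
length-unbeta []       = refl
length-unbeta (_ ∷ as) = cong ℕ.suc (length-unbeta as)

-- A strictly decreasing list of naturals drops by at least one at each step and ends at or above
-- zero. This keeps the subtraction in `unbeta` from truncating.
length-tail≤head : ∀ {a as} → Linked _>_ (a ∷ as) → length as ≤ a
length-tail≤head [-]       = z≤n
length-tail≤head (a>b ∷ l) = ℕ.≤-<-trans (length-tail≤head l) a>b

-- Since `unbeta` preserves length, `beta` adds back at each position exactly the amount that was
-- subtracted there.
beta-unbeta : ∀ {as} → Linked _>_ as → beta (unbeta as) ≡ as
beta-unbeta []                  = refl
beta-unbeta {a ∷ []} [-]        = cong (_∷ []) (ℕ.+-identityʳ a)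
beta-unbeta {a ∷ as} (a>b ∷ l) = cong₂ _∷_
  (trans (cong (a ℕ.∸ length as ℕ.+_) (length-unbeta as))
         (ℕ.m∸n+n≡m (length-tail≤head (a>b ∷ l))))
  (beta-unbeta l)

module _ (t : ℕ) .{{_ : NonZero t}} where

  fromQuotients : ℕ → List ℕ → List ℕ
  fromQuotients r = map (λ ã → r ℕ.+ ã ℕ.* t)

  fromQuotients-/ : ∀ {r xs} → All (λ x → x ℕ.% t ≡ r) xs →
                    fromQuotients r (map (ℕ._/ t) xs) ≡ xs
  fromQuotients-/ []                        = refl
  -- Matching `refl` replaces `r` by `x % t`, so the head is division with remainder.
  fromQuotients-/ {xs = x ∷ _} (refl ∷ pxs) =
    cong₂ _∷_ (sym (m≡m%n+[m/n]*n x t)) (fromQuotients-/ pxs)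

  residueClass-quotient : ∀ μ i →
    fromQuotients (toℕ i) (beta (parts (quotient t μ i))) ≡ residueClass t μ i
  residueClass-quotient μ i = trans
    (cong (fromQuotients (toℕ i))
          (beta-unbeta (map-/-decreasing t inClass (residueClass-decreasing t μ i))))
    (fromQuotients-/ inClass)
    where inClass = all-filter (λ x → x ℕ.% t ℕ.≟ toℕ i) (beta (parts μ))

  pos-fromQuotient : ∀ r ã → + (r ℕ.+ ã ℕ.* t) ≡ + r + + ã * + t
  -- The sum of two `+` terms computes, so only the product needs rewriting.
  pos-fromQuotient r ã = cong (_+_ (+ r)) (pos-* ã t)

  -- Here `n` counts the parts after the second of two consecutive ones. Their beta shifts are
  -- `suc n` and `n`; the common residue and `n` cancel, and the leftover shift is the `+ 1`.
  d-fromQuotients : ∀ r x y n →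
    d (r ℕ.+ (x ℕ.+ ℕ.suc n) ℕ.* t , r ℕ.+ (y ℕ.+ n) ℕ.* t) ≡ + t * (+ x - + y + + 1)
  d-fromQuotients r x y n = trans
    (cong₂ _-_ (pos-fromQuotient r (x ℕ.+ ℕ.suc n)) (pos-fromQuotient r (y ℕ.+ n)))
    (identity (+ t) (+ r) (+ x) (+ y) (+ n))
    where
    identity : ∀ T R X Y N →
      (R + (X + (+ 1 + N)) * T) - (R + (Y + N) * T) ≡ T * (X - Y + + 1)
    identity = solve-∀

  pair-difference : ∀ r ν {a₁ a₂} →
    fromQuotients r (beta (parts ν)) ≡ a₁ ∷ a₂ ∷ [] →
    d (a₁ , a₂) ≡ + t * (k ν + + 1)
  -- Both `beta` and `fromQuotients` preserve length, so only a two-part list can match; no part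
  -- follows `y`, hence `0`.
  pair-difference r (partition (x ∷ y ∷ []) _) refl = d-fromQuotients r x y 0

  -- The beta shifts 1 and 0 contribute one extra `t`, and each of the two elements contributes its
  -- residue once.
  pair-sum : ∀ r ν {a₁ a₂} →
    fromQuotients r (beta (parts ν)) ≡ a₁ ∷ a₂ ∷ [] →
    + a₁ + + a₂ ≡ + t * (+ size ν + + 1) + + 2 * + r
  pair-sum r (partition (x ∷ y ∷ []) _) refl = trans
    (cong₂ _+_ (pos-fromQuotient r (x ℕ.+ 1)) (pos-fromQuotient r (y ℕ.+ 0)))
    (identity (+ t) (+ r) (+ x) (+ y))
    where
    -- The terms `Y + + 0` mirror the zero shift of the last part on the left and the end of `sum`
    -- on the right.
    identity : ∀ T R X Y →
      (R + (X + + 1) * T) + (R + (Y + + 0) * T) ≡ T * (X + (Y + + 0) + + 1) + + 2 * R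
    identity = solve-∀

  triple-differences : ∀ r ν {p q s} →
    fromQuotients r (beta (parts ν)) ≡ p ∷ q ∷ s ∷ [] →
    ∃[ ν₁ ] ∃[ ν₂ ] ∃[ ν₃ ]
      (parts ν ≡ ν₁ ∷ ν₂ ∷ ν₃ ∷ []
      × d (p , q) ≡ + t * (+ ν₁ - + ν₂ + + 1)
      × d (q , s) ≡ + t * (+ ν₂ - + ν₃ + + 1))
  triple-differences r (partition (x ∷ y ∷ z ∷ []) _) refl =
    -- One part follows `y` and none follows `z`.
    x , y , z , refl , d-fromQuotients r x y 1 , d-fromQuotients r y z 0

d̃₃-sums : ∀ a₁ a₂ b₁ b₂ → d̃₃ (a₁ , a₂) (b₁ , b₂) ≡ (+ a₁ + + a₂) - (+ b₁ + + b₂)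
d̃₃-sums a₁ a₂ b₁ b₂ = identity (+ a₁) (+ a₂) (+ b₁) (+ b₂)
  where
  identity : ∀ A A′ B B′ → A + A′ - B - B′ ≡ (A + A′) - (B + B′)
  identity = solve-∀

-- The middle element lies in both pairs and cancels, and the remaining difference telescopes
-- through it.
d̃₃-overlap : ∀ p q r → d̃₃ (p , q) (q , r) ≡ d (p , q) + d (q , r)
d̃₃-overlap p q r = identity (+ p) (+ q) (+ r)
  where
  identity : ∀ P Q R → P + Q - Q - R ≡ (P - Q) + (Q - R)
  identity = solve-∀

proposition3p4 : (t : ℕ) .{{_ : NonZero t}} → 2 ≤ t →
    (μ : Partition) → length (parts μ) ≡ t ℕ.+ 2 →
    ((rA rB : Fin t) → TwoClassProfile t μ rA rB →
    (a₁ a₂ b₁ b₂ : ℕ) →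
    residueClass t μ rA ≡ a₁ ∷ a₂ ∷ [] →
    residueClass t μ rB ≡ b₁ ∷ b₂ ∷ [] →
    d (a₁ , a₂) ≡ + t * (k (quotient t μ rA) + + 1)
    × d (b₁ , b₂) ≡ + t * (k (quotient t μ rB) + + 1)
    × d̃₃ (a₁ , a₂) (b₁ , b₂)
    ≡ + t * (+ size (quotient t μ rA) - + size (quotient t μ rB))
    + + 2 * (+ toℕ rA - + toℕ rB))
    ×
    ((rA : Fin t) → SizeThreeProfile t μ rA →
    (p q r : ℕ) →
    residueClass t μ rA ≡ p ∷ q ∷ r ∷ [] →
    ∃[ ν₁ ] ∃[ ν₂ ] ∃[ ν₃ ]
    (parts (quotient t μ rA) ≡ ν₁ ∷ ν₂ ∷ ν₃ ∷ []
    × d (p , q) ≡ + t * (+ ν₁ - + ν₂ + + 1)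
    × d (q , r) ≡ + t * (+ ν₂ - + ν₃ + + 1)
    × d̃₃ (p , q) (q , r) ≡ d (p , q) + d (q , r)))
proposition3p4 t _ μ _ = twoClass , sizeThree
  where
  twoClass : (rA rB : Fin t) → TwoClassProfile t μ rA rB →
    (a₁ a₂ b₁ b₂ : ℕ) →
    residueClass t μ rA ≡ a₁ ∷ a₂ ∷ [] →
    residueClass t μ rB ≡ b₁ ∷ b₂ ∷ [] →
    d (a₁ , a₂) ≡ + t * (k (quotient t μ rA) + + 1)
    × d (b₁ , b₂) ≡ + t * (k (quotient t μ rB) + + 1)
    × d̃₃ (a₁ , a₂) (b₁ , b₂)
    ≡ + t * (+ size (quotient t μ rA) - + size (quotient t μ rB))
    + + 2 * (+ toℕ rA - + toℕ rB)
  twoClass rA rB _ a₁ a₂ b₁ b₂ eqA eqB =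
      pair-difference t (toℕ rA) νA eqA′
    , pair-difference t (toℕ rB) νB eqB′
    , (begin
        d̃₃ (a₁ , a₂) (b₁ , b₂)
          ≡⟨ d̃₃-sums a₁ a₂ b₁ b₂ ⟩
        (+ a₁ + + a₂) - (+ b₁ + + b₂)
          ≡⟨ cong₂ _-_ (pair-sum t (toℕ rA) νA eqA′) (pair-sum t (toℕ rB) νB eqB′) ⟩
        (+ t * (+ size νA + + 1) + + 2 * + toℕ rA) - (+ t * (+ size νB + + 1) + + 2 * + toℕ rB)
          ≡⟨ identity (+ t) (+ size νA) (+ size νB) (+ toℕ rA) (+ toℕ rB) ⟩
        + t * (+ size νA - + size νB) + + 2 * (+ toℕ rA - + toℕ rB) ∎)
    where
    open ≡-Reasoning
    νA νB : Partition
    νA = quotient t μ rA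
    νB = quotient t μ rB
    -- This presents the listed elements as rebuilt from the quotient, so the pair lemmas apply.
    eqA′ = trans (residueClass-quotient t μ rA) eqA
    eqB′ = trans (residueClass-quotient t μ rB) eqB
    -- Both sums carry the same shift `T * + 1`, so only sizes and residues survive.
    identity : ∀ T S S′ R R′ →
      (T * (S + + 1) + + 2 * R) - (T * (S′ + + 1) + + 2 * R′) ≡ T * (S - S′) + + 2 * (R - R′)
    identity = solve-∀

  sizeThree : (rA : Fin t) → SizeThreeProfile t μ rA →
    (p q r : ℕ) →
    residueClass t μ rA ≡ p ∷ q ∷ r ∷ [] →
    ∃[ ν₁ ] ∃[ ν₂ ] ∃[ ν₃ ]
    (parts (quotient t μ rA) ≡ ν₁ ∷ ν₂ ∷ ν₃ ∷ []
    × d (p , q) ≡ + t * (+ ν₁ - + ν₂ + + 1)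
    × d (q , r) ≡ + t * (+ ν₂ - + ν₃ + + 1)
    × d̃₃ (p , q) (q , r) ≡ d (p , q) + d (q , r))
  sizeThree rA _ p q r eq =
    let ν₁ , ν₂ , ν₃ , ν≡ , d₁≡ , d₂≡ = triple-differences t (toℕ rA) (quotient t μ rA)
                                          (trans (residueClass-quotient t μ rA) eq)
    in ν₁ , ν₂ , ν₃ , ν≡ , d₁≡ , d₂≡ , d̃₃-overlap p q r
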